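{- Let $G=(V,E)$ be a graph which is an $n$-convex geometry. Then $G$ is true twins free, i.e., there are no two distinct vertices $x,y\in V$ with $N[x]=N[y]$.
   Context: All graphs are finite, simple and undirected, with non-empty vertex set. For a graph $G=(V,E)$ and $x\in V$, the closed neighbourhood of $x$ is $N[x]=\{x\}\cup\{y\in V:\{x,y\}\in E\}$. For $Y\subseteq V$, the common closed neighbourhood is $N[Y]=\bigcap_{y\in Y}N[y]$ if $Y\neq\varnothing$, and $N[\varnothing]=V$. The neighbourhood convexity of $G$ is the family $n_G=\{N[Y]:Y\subseteq V\}\cup\{\varnothing\}$ of subsets of $V$; it contains $\varnothing$ and $V$ and is closed under intersection. Its members are called $n$-convex sets. For $X\subseteq V$ the convex hull $[X]_{n}$ is the intersection of all $n$-convex sets containing $X$. For an $n$-convex set $K$, $\operatorname{ex}(K)=\{x\in K: K\setminus\{x\}\in n_G\}$ is the set of extreme points of $K$. $G$ is an $n$-convex geometry if $K=[\operatorname{ex}(K)]_{n}$ for every $n$-convex set $K$. -}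

module Defs where

open import Level using (0ℓ)
open import Data.Bool.Properties using () renaming (_≟_ to _≟ᵇ_)
open import Data.Nat.Base using (ℕ; zero; suc)
open import Data.Fin.Base using (Fin)
open import Data.Fin.Subset
  using (Subset; inside; outside; ⊥; ⁅_⁆; _∈_; _⊆_; _∪_; _-_; ⋂)
open import Data.Fin.Subset.Properties using (_∈?_; _⊆?_; anySubset?)
open import Data.List.Base using (List; []; _∷_; _++_; map; filter; allFin)
open import Data.List.Membership.Propositional using () renaming (_∈_ to _∈ˡ_)
open import Data.List.Membership.Propositional.Properties
  using (∈-map⁺; ∈-++⁺ˡ; ∈-++⁺ʳ)
open import Data.List.Relation.Unary.Any using (here)
open import Data.Product.Base using (∃-syntax; ∃₂; _×_)
open import Data.Sum.Base using (_⊎_)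
open import Data.Vec.Base using ([]; _∷_; tabulate)
open import Data.Vec.Properties using (≡-dec)
open import Relation.Binary.Core using (Rel)
open import Relation.Binary.Definitions
  using (Decidable; DecidableEquality; Symmetric; Irreflexive)
open import Relation.Binary.PropositionalEquality using (_≡_; _≢_; refl)
open import Relation.Nullary using (Dec; does; ¬_)
open import Relation.Nullary.Decidable using (_×-dec_; _⊎-dec_)

-- Simple undirected graphs with vertex set Fin n.
record Graph (n : ℕ) : Set₁ where
  field
    Adj    : Rel (Fin n) 0ℓ
    adj?   : Decidable Adj
    sym    : Symmetric Adj
    irrefl : Irreflexive _≡_ Adj

infix 4 _≟ˢ_
_≟ˢ_ : ∀ {n} → DecidableEquality (Subset n)
_≟ˢ_ = ≡-dec _≟ᵇ_

subsets : ∀ n → List (Subset n)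
subsets zero    = [] ∷ []
subsets (suc n) = map (inside ∷_) (subsets n) ++ map (outside ∷_) (subsets n)

∈-subsets : ∀ {n} (p : Subset n) → p ∈ˡ subsets n
∈-subsets []            = here refl
∈-subsets (inside ∷ p)  = ∈-++⁺ˡ (∈-map⁺ (inside ∷_) (∈-subsets p))
∈-subsets (outside ∷ p) =
  ∈-++⁺ʳ (map (inside ∷_) (subsets _)) (∈-map⁺ (outside ∷_) (∈-subsets p))

module _ {n : ℕ} (G : Graph n) where
  open Graph G

  N[_] : Fin n → Subset n
  N[ x ] = ⁅ x ⁆ ∪ tabulate (λ y → does (adj? x y))

  -- Since ⋂ [] = ⊤, the common closed neighbourhood of ∅ is the whole
  -- vertex set.
  commonN : Subset n → Subset n
  commonN Y = ⋂ (map N[_] (filter (_∈? Y) (allFin n)))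

  NConvex : Subset n → Set
  NConvex K = (∃[ Y ] K ≡ commonN Y) ⊎ K ≡ ⊥

  nConvex? : ∀ K → Dec (NConvex K)
  nConvex? K = anySubset? (λ Y → K ≟ˢ commonN Y) ⊎-dec (K ≟ˢ ⊥)

  hull : Subset n → Subset n
  hull X = ⋂ (filter (λ K → nConvex? K ×-dec (X ⊆? K)) (subsets n))

  ex : Subset n → Subset n
  ex K = tabulate (λ x → does ((x ∈? K) ×-dec nConvex? (K - x)))

  NConvexGeometry : Set
  NConvexGeometry = ∀ K → NConvex K → K ≡ hull (ex K)

  TrueTwinsFree : Set
  TrueTwinsFree = ¬ (∃₂ λ x y → x ≢ y × N[ x ] ≡ N[ y ])

{-# OPTIONS --safe #-}

-- N[N[x]] is the smallest convex set containing x, so removing any point but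
-- x from it destroys convexity: x is its only possible extreme point.  If x
-- and y are true twins, then N[N[x]] = N[N[y]], whose extreme points would
-- have to equal both x and y.  So it has none, and it would be the hull of ∅,
-- which is ∅; yet it contains x.
module Submission where

open import Data.Bool.Base using (true)
open import Data.Nat.Base using (ℕ; NonZero)
open import Data.Fin.Base using (Fin)
open import Data.Fin.Properties using (_≟_)
open import Data.Fin.Subset using (Subset; _∈_; _⊆_; _-_; ⊥; ⋂)
open import Data.Fin.Subset.Properties
  using (_∈?_; _⊆?_; ∉⊥; ∈⊤; x∈⁅y⁆⇒x≡y; x∈p∩q⁺; x∈p∩q⁻; x∈p∪q⁺; x∈p∪q⁻;
         x∈p∧x≢y⇒x∈p-y; x∈p⇒p-x⊂p)
open import Data.List.Base using (List; []; _∷_; allFin)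
open import Data.List.Membership.Propositional using () renaming (_∈_ to _∈ˡ_)
open import Data.List.Membership.Propositional.Properties
  using (∈-map⁺; ∈-map⁻; ∈-filter⁺; ∈-filter⁻; ∈-allFin)
open import Data.List.Relation.Unary.Any using (here; there)
open import Data.Product.Base using (_×_; _,_; proj₁; proj₂)
open import Data.Sum.Base using (inj₁; inj₂)
open import Data.Vec.Base using (tabulate)
open import Data.Vec.Properties using (lookup∘tabulate; lookup⇒[]=; []=⇒lookup)
open import Relation.Binary.PropositionalEquality
  using (_≡_; refl; sym; trans; subst)
open import Relation.Nullary using (Dec; yes; no; does; contradiction)
open import Relation.Nullary.Decidable using (dec-true; _×-dec_)
open import Relation.Unary using (Pred; Decidable)
open import Defs

private
  variable
    n : ℕ
    x : Fin n

does-true : ∀ {a} {A : Set a} (a? : Dec A) → does a? ≡ true → A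
does-true (yes a) _ = a

module _ {p} {P : Pred (Fin n) p} (P? : Decidable P) where

  ∈-tabulate-does⁺ : P x → x ∈ tabulate (λ y → does (P? y))
  ∈-tabulate-does⁺ {x = x} px =
    lookup⇒[]= x _ (trans (lookup∘tabulate _ x) (dec-true (P? x) px))

  ∈-tabulate-does⁻ : x ∈ tabulate (λ y → does (P? y)) → P x
  ∈-tabulate-does⁻ {x = x} x∈ =
    does-true (P? x) (trans (sym (lookup∘tabulate _ x)) ([]=⇒lookup x∈))

x∈⋂⁺ : (ps : List (Subset n)) → (∀ {p} → p ∈ˡ ps → x ∈ p) → x ∈ ⋂ ps
x∈⋂⁺ []       _  = ∈⊤
x∈⋂⁺ (p ∷ ps) x∈ = x∈p∩q⁺ (x∈ (here refl) , x∈⋂⁺ ps (λ q∈ → x∈ (there q∈)))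

⋂⊆ : ∀ {ps : List (Subset n)} {p} → p ∈ˡ ps → ⋂ ps ⊆ p
⋂⊆ (here refl) x∈ = proj₁ (x∈p∩q⁻ _ _ x∈)
⋂⊆ (there p∈)  x∈ = ⋂⊆ p∈ (proj₂ (x∈p∩q⁻ _ _ x∈))

module _ (G : Graph n) where
  open Graph G using (adj?) renaming (sym to adj-sym)

  N-sym : ∀ {x y} → x ∈ N[ G ] y → y ∈ N[ G ] x
  N-sym {x} {y} x∈ with x∈p∪q⁻ _ _ x∈
  ... | inj₂ x∈A = x∈p∪q⁺ (inj₂ (∈-tabulate-does⁺ (adj? x)
                     (adj-sym (∈-tabulate-does⁻ (adj? y) x∈A))))
  -- Here `x` and `y` coincide, so the hypothesis is already the goal.
  ... | inj₁ x∈y with refl ← x∈⁅y⁆⇒x≡y y x∈y = x∈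

  ∈-commonN⁺ : ∀ {Y} → (∀ {y} → y ∈ Y → x ∈ N[ G ] y) → x ∈ commonN G Y
  ∈-commonN⁺ {x = x} {Y} x∈N = x∈⋂⁺ _ x∈
    where
    x∈ : ∀ {p} → p ∈ˡ _ → x ∈ p
    x∈ p∈ with y , y∈ , refl ← ∈-map⁻ (N[_] G) p∈ =
      x∈N (proj₂ (∈-filter⁻ (_∈? Y) {xs = allFin n} y∈))

  commonN⊆N : ∀ {Y y} → y ∈ Y → commonN G Y ⊆ N[ G ] y
  commonN⊆N {Y} {y} y∈Y =
    ⋂⊆ (∈-map⁺ (N[_] G) (∈-filter⁺ (_∈? Y) (∈-allFin y) y∈Y))

  -- By symmetry, `x` lies in the closed neighbourhood of each of its neighbours and of itself.
  x∈N[N[x]] : ∀ x → x ∈ commonN G (N[ G ] x)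
  x∈N[N[x]] x = ∈-commonN⁺ N-sym

  -- If `C` is N[Y] and contains `x`, symmetry puts all of Y inside N[x]; taking common
  -- neighbourhoods reverses inclusions.
  N[N[x]]-least : ∀ {C} → NConvex G C → x ∈ C → commonN G (N[ G ] x) ⊆ C
  N[N[x]]-least (inj₂ refl)       x∈C = contradiction x∈C ∉⊥
  N[N[x]]-least (inj₁ (Y , refl)) x∈C z∈ =
    ∈-commonN⁺ (λ y∈Y → commonN⊆N (N-sym (commonN⊆N y∈Y x∈C)) z∈)

  ex⁻ : ∀ {K} → x ∈ ex G K → x ∈ K × NConvex G (K - x)
  ex⁻ {K = K} = ∈-tabulate-does⁻ (λ x → (x ∈? K) ×-dec nConvex? G (K - x))

  z∈ex-N[N[x]]⇒x≡z : ∀ {x z} → z ∈ ex G (commonN G (N[ G ] x)) → x ≡ z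
  z∈ex-N[N[x]]⇒x≡z {x} {z} z∈ex with x ≟ z
  ... | yes x≡z = x≡z
  ... | no  x≢z =
    let z∈K , K-z-convex  = ex⁻ z∈ex
        -- Strictness of the inclusion provides a point `w` lost by removing `z`; leastness of
        -- N[N[x]] would put it back.
        _ , w , w∈K , w∉K-z = x∈p⇒p-x⊂p z∈K
        x∈K-z = x∈p∧x≢y⇒x∈p-y (x∈N[N[x]] x) x≢z
    in contradiction (N[N[x]]-least K-z-convex x∈K-z w∈K) w∉K-z

  -- `subsets` lists every subset, so `C` survives the filter and is one of the sets intersected.
  hull-least : ∀ {X C} → NConvex G C → X ⊆ C → hull G X ⊆ C
  hull-least {X} {C} C-convex X⊆C =
    ⋂⊆ (∈-filter⁺ (λ K → nConvex? G K ×-dec (X ⊆? K)) (∈-subsets C)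
                  (C-convex , X⊆C))

theorem14 : (n : ℕ) .{{_ : NonZero n}} (G : Graph n) → NConvexGeometry G → TrueTwinsFree G
theorem14 n G geometry (x , y , x≢y , Nx≡Ny) =
  -- The empty set is convex by definition, so it bounds the hull of a set without points.
  ∉⊥ (hull-least G (inj₂ refl) ex⊆⊥ x∈hull)
  where
  K = commonN G (N[ G ] x)

  x∈hull : x ∈ hull G (ex G K)
  x∈hull = subst (x ∈_) (geometry K (inj₁ (N[ G ] x , refl))) (x∈N[N[x]] G x)

  ex⊆⊥ : ex G K ⊆ ⊥
  ex⊆⊥ {z} z∈ex = contradiction (trans (z∈ex-N[N[x]]⇒x≡z G z∈ex) (sym y≡z)) x≢y
    where
    y≡z : y ≡ z
    -- The twin equation turns `K` into N[N[y]], so the same lemma applies with `y` in the role of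
    -- `x`.
    y≡z = z∈ex-N[N[x]]⇒x≡z G (subst (λ N → z ∈ ex G (commonN G N)) Nx≡Ny z∈ex)
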